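{- $\mathsf{SEL}_{K,\Box,B}$ is a sound and complete axiomatization of $\mathcal{L}_{K,\Box,B}$ with respect to the class of topological subset models: for every $\varphi\in\mathcal{L}_{K,\Box,B}$, $\varphi$ is valid in all topological subset models if and only if $\varphi$ is provable in $\mathsf{SEL}_{K,\Box,B}$.
   Context: Language. Fix a countable set PROP of primitive propositions. $\mathcal{L}_{K,\Box,B}$ is generated by $\varphi ::= p \mid \neg\varphi \mid \varphi\wedge\psi \mid K\varphi\mid\Box\varphi\mid B\varphi$, $p\in$ PROP. The connectives $\vee,\to,\leftrightarrow$ are defined as usual and $\Diamond := \neg\Box\neg$. Semantics. A topological subset model is a triple $\mathcal{X}=(X,\mathcal{T},v)$ where $X$ is a nonempty set, $\mathcal{T}$ is a topology on $X$, and $v:\mathrm{PROP}\to 2^X$. An epistemic scenario of $\mathcal X$ is a pair $(x,U)$ with $x\in U\in\mathcal{T}$. Let $\mathit{int}$ and $\mathit{cl}$ denote interior and closure in $(X,\mathcal{T})$, and let $[\![\varphi]\!]^{U}=\{y\in U : (\mathcal{X},y,U)\models\varphi\}$. Truth at an epistemic scenario is defined by: $(\mathcal{X},x,U)\models p$ iff $x\in v(p)$; $(\mathcal{X},x,U)\models\neg\varphi$ iff $(\mathcal{X},x,U)\not\models\varphi$; $(\mathcal{X},x,U)\models\varphi\wedge\psi$ iff $(\mathcal{X},x,U)\models\varphi$ and $(\mathcal{X},x,U)\models\psi$; $(\mathcal{X},x,U)\models K\varphi$ iff $(\mathcal{X},y,U)\models\varphi$ for all $y\in U$; $(\mathcal{X},x,U)\models\Box\varphi$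 iff $x\in\mathit{int}([\![\varphi]\!]^{U})$; $(\mathcal{X},x,U)\models B\varphi$ iff $U\subseteq\mathit{cl}(\mathit{int}([\![\varphi]\!]^{U}))$. A formula is valid in $\mathcal{X}$ if it is true at every epistemic scenario of $\mathcal X$. The logic $\mathsf{SEL}_{K,\Box,B}$ is the Hilbert system (schemes and rules ranging over formulas of $\mathcal{L}_{K,\Box,B}$) consisting of classical propositional logic (with modus ponens) plus: the $\mathsf{S5}$ principles for $K$: $K(\varphi\to\psi)\to(K\varphi\to K\psi)$, $K\varphi\to\varphi$, $K\varphi\to KK\varphi$, $\neg K\varphi\to K\neg K\varphi$, and the rule "from $\vdash\varphi$ infer $\vdash K\varphi$"; the $\mathsf{S4}$ principles for $\Box$: $\Box(\varphi\to\psi)\to(\Box\varphi\to\Box\psi)$, $\Box\varphi\to\varphi$, $\Box\varphi\to\Box\Box\varphi$, and the rule "from $\vdash\varphi$ infer $\vdash\Box\varphi$"; the schemes $(\mathrm{KI})$ $K\varphi\to\Box\varphi$; $(\mathrm{K}_B)$ $B(\varphi\to\psi)\to(B\varphi\to B\psi)$; $(\mathrm{sPI})$ $B\varphi\to KB\varphi$; $(\mathrm{KB})$ $K\varphi\to B\varphi$; $(\mathrm{RB})$ $B\varphi\to B\Box\varphi$; $(\mathrm{wF})$ $B\varphi\to\Diamond\varphi$; $(\mathrm{CB})$ $B(\Box\varphi\vee\Box\neg\Box\varphi)$. -}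

module Defs where

open import Data.Bool.Base using (Bool; true; not) renaming (_∧_ to _&&_)
open import Data.Product.Base using (_×_; ∃-syntax)
open import Level using (Level; Lift; suc; _⊔_)
open import Relation.Binary.PropositionalEquality.Core using (_≡_)
open import Relation.Nullary.Negation.Core using (¬_)
open import Relation.Unary using (Pred; _∈_; _⊆_; _≐_; _∩_; ∁; ⋃)
open import Relation.Unary.Polymorphic using (∅; U)

private
  variable
    a ℓ : Level
    PROP : Set

infix  30 ~_ K_ □_ B_ ◇_
infixr 25 _∧_
infixr 24 _∨_
infixr 23 _⇒_
infix  4  ⊢_ ⟨_,_,_⟩⊨_

data Formula (PROP : Set) : Set where
  atom : PROP → Formula PROP
  ~_   : Formula PROP → Formula PROP
  _∧_  : Formula PROP → Formula PROP → Formula PROP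
  K_   : Formula PROP → Formula PROP
  □_   : Formula PROP → Formula PROP
  B_   : Formula PROP → Formula PROP

_∨_ : Formula PROP → Formula PROP → Formula PROP
φ ∨ ψ = ~ (~ φ ∧ ~ ψ)

_⇒_ : Formula PROP → Formula PROP → Formula PROP
φ ⇒ ψ = ~ (φ ∧ ~ ψ)

◇_ : Formula PROP → Formula PROP
◇ φ = ~ (□ (~ φ))

-- A subset of X is a predicate, and equality of subsets is _≐_, so a family
-- of open sets must be closed under _≐_ explicitly.
record Topology (X : Set ℓ) : Set (suc (suc ℓ)) where
  field
    Open   : Pred (Pred X ℓ) (suc ℓ)
    resp-≐ : ∀ {V W} → V ≐ W → Open V → Open W
    ∅-open : Open ∅
    U-open : Open U
    ∩-open : ∀ {V W} → Open V → Open W → Open (V ∩ W)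
    ⋃-open : ∀ {I : Set ℓ} (V : I → Pred X ℓ) →
             (∀ i → Open (V i)) → Open (⋃ I V)

  Closed : Pred (Pred X ℓ) (suc ℓ)
  Closed C = Open (∁ C)

  -- The union of the open subsets of A, respectively the intersection of the
  -- closed supersets of A. Both quantify over subsets of X, hence the rise in
  -- level; A may itself live at a higher level than the open sets.
  int : Pred X a → Pred X (a ⊔ suc ℓ)
  int A x = ∃[ V ] Open V × V ⊆ A × x ∈ V

  cl : Pred X a → Pred X (a ⊔ suc ℓ)
  cl A x = ∀ C → Closed C → A ⊆ C → x ∈ C

record Model (ℓ : Level) (PROP : Set) : Set (suc (suc ℓ)) where
  field
    X        : Set ℓ
    nonempty : X
    topology : Topology X
    v        : PROP → Pred X ℓ

  open Topology topology public

-- Truth is defined at every pair (x , V); only epistemic scenarios, where V is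
-- open and x ∈ V, matter for validity, and the clauses never leave them.
mutual
  ⟨_,_,_⟩⊨_ : (M : Model ℓ PROP) → Model.X M → Pred (Model.X M) ℓ →
              Formula PROP → Set (suc ℓ)
  ⟨_,_,_⟩⊨_ {ℓ} M x V (atom p) = Lift (suc ℓ) (x ∈ Model.v M p)
  ⟨ M , x , V ⟩⊨ (~ φ)         = ¬ (⟨ M , x , V ⟩⊨ φ)
  ⟨ M , x , V ⟩⊨ (φ ∧ ψ)       = (⟨ M , x , V ⟩⊨ φ) × (⟨ M , x , V ⟩⊨ ψ)
  ⟨ M , x , V ⟩⊨ (K φ)         = ∀ y → y ∈ V → ⟨ M , y , V ⟩⊨ φ
  ⟨ M , x , V ⟩⊨ (□ φ)         = x ∈ Model.int M (⟦ φ ⟧ M V)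
  ⟨ M , x , V ⟩⊨ (B φ)         = V ⊆ Model.cl M (Model.int M (⟦ φ ⟧ M V))

  ⟦_⟧ : Formula PROP → (M : Model ℓ PROP) →
        Pred (Model.X M) ℓ → Pred (Model.X M) (suc ℓ)
  ⟦ φ ⟧ M V y = y ∈ V × ⟨ M , y , V ⟩⊨ φ

ValidIn : Model ℓ PROP → Formula PROP → Set (suc ℓ)
ValidIn M φ = ∀ x V → Open V → x ∈ V → ⟨ M , x , V ⟩⊨ φ
  where open Model M

Valid : (ℓ : Level) → Formula PROP → Set (suc (suc ℓ))
Valid {PROP} ℓ φ = (M : Model ℓ PROP) → ValidIn M φ

-- Boolean evaluation in which the atoms and the formulas of the form K φ, □ φ
-- or B φ are all treated as propositional variables.
eval : (Formula PROP → Bool) → Formula PROP → Bool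
eval ρ (~ φ)   = not (eval ρ φ)
eval ρ (φ ∧ ψ) = eval ρ φ && eval ρ ψ
eval ρ φ       = ρ φ

Tautology : Formula PROP → Set
Tautology φ = ∀ ρ → eval ρ φ ≡ true

data ⊢_ {PROP : Set} : Formula PROP → Set where
  taut  : ∀ {φ} → Tautology φ → ⊢ φ
  MP    : ∀ {φ ψ} → ⊢ φ ⇒ ψ → ⊢ φ → ⊢ ψ

  K-K   : ∀ φ ψ → ⊢ K (φ ⇒ ψ) ⇒ (K φ ⇒ K ψ)
  K-T   : ∀ φ → ⊢ K φ ⇒ φ
  K-4   : ∀ φ → ⊢ K φ ⇒ K (K φ)
  K-5   : ∀ φ → ⊢ ~ (K φ) ⇒ K (~ (K φ))
  K-nec : ∀ {φ} → ⊢ φ → ⊢ K φ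

  □-K   : ∀ φ ψ → ⊢ □ (φ ⇒ ψ) ⇒ (□ φ ⇒ □ ψ)
  □-T   : ∀ φ → ⊢ □ φ ⇒ φ
  □-4   : ∀ φ → ⊢ □ φ ⇒ □ (□ φ)
  □-nec : ∀ {φ} → ⊢ φ → ⊢ □ φ

  KI    : ∀ φ → ⊢ K φ ⇒ □ φ
  B-K   : ∀ φ ψ → ⊢ B (φ ⇒ ψ) ⇒ (B φ ⇒ B ψ)
  sPI   : ∀ φ → ⊢ B φ ⇒ K (B φ)
  KB    : ∀ φ → ⊢ K φ ⇒ B φ
  RB    : ∀ φ → ⊢ B φ ⇒ B (□ φ)
  wF    : ∀ φ → ⊢ B φ ⇒ ◇ φ
  CB    : ∀ φ → ⊢ B (□ φ ∨ □ (~ (□ φ)))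

{-# OPTIONS --safe #-}

-- Soundness is a direct computation with open sets.  For completeness, B φ is
-- provably equivalent to K ◇ □ φ: one direction combines RB, wF and sPI, the
-- other CB and KB.  The canonical model consists of the maximal consistent
-- sets, with the up-sets of the canonical □-relation as open sets.  By KI the
-- class of points that agree on all formulas K φ is open, and truth of φ at x
-- relative to this class is membership of φ in x.

module Submission where

open import Defs
open import Axiom.ExcludedMiddle using (ExcludedMiddle)
open import Data.Bool.Base using (Bool; true; false; not) renaming (_∧_ to _&&_)
open import Data.Empty using (⊥-elim)
open import Data.List.Base using (List; []; _∷_; [_]; _++_; map; foldr; cartesianProductWith)
open import Data.List.Membership.Propositional using (_∈_)
open import Data.List.Membership.Propositional.Properties
  using (∈-map⁺; ∈-++⁺ˡ; ∈-++⁺ʳ; ∈-cartesianProductWith⁺)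
open import Data.List.Relation.Unary.Any using (here; there)
open import Data.Nat.Base using (ℕ; zero; _≤_; _≤′_; ≤′-refl; ≤′-step; _⊔_)
open import Data.Nat.Properties using (≤⇒≤′; m≤m⊔n; m≤n⊔m)
open import Data.Product.Base using (_×_; _,_; proj₁; proj₂; ∃-syntax; map₂)
open import Data.Sum.Base using (_⊎_; inj₁; inj₂; [_,_]′)
open import Function.Base using (_∘_; id)
open import Function.Bundles using (_↣_; _⇔_; mk⇔; Injection)
open import Level using (Level; Lift; lift; lower; suc)
open import Relation.Binary.PropositionalEquality
  using (_≡_; refl; sym; trans; cong; cong₂)
open import Relation.Nullary using (¬_; Dec; yes; no; does)
open import Relation.Nullary.Decidable using (map′; decidable-stable)
open import Relation.Unary using (Pred; _⊆_; ∁)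

private
  variable
    PROP : Set

-- Truth lives at level `suc ℓ`, subsets at `ℓ` and maximal consistent sets at level zero; one
-- assumption has to serve all three.
lower-em : ∀ {a} b → ExcludedMiddle (a Level.⊔ b) → ExcludedMiddle a
lower-em b em {P} = map′ lower lift (em {Lift b P})

-- Soundness

module Soundness {ℓ : Level} (em : ExcludedMiddle (suc ℓ))
                 (M : Model ℓ PROP) where

  open Model M

  dne : ∀ {P : Set (suc ℓ)} → ¬ ¬ P → P
  dne = decidable-stable em

  dneℓ : ∀ {P : Set ℓ} → ¬ ¬ P → P
  dneℓ = decidable-stable (lower-em (suc ℓ) em)

  -- If `W` missed `A`, then `∁ W` would be a closed superset of `A` without `y`. It is closed
  -- because its own complement agrees with `W` classically.
  meets : ∀ (A : Pred X (suc ℓ)) {W y} → Open W → W y → cl A y →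
          ∃[ z ] W z × A z
  meets A {W} {y} oW y∈W y∈clA = dne λ none →
    y∈clA (∁ W) (resp-≐ ((λ w nw → nw w) , dneℓ) oW)
      (λ a w → none (_ , w , a)) y∈W

  cl-intro : ∀ (A : Pred X (suc ℓ)) {y} →
             (∀ W → Open W → W y → ∃[ z ] W z × A z) → cl A y
  cl-intro A f C closed A⊆C = dneℓ λ y∉C →
    let z , z∉C , a = f (∁ C) closed y∉C in z∉C (A⊆C a)

  int-mono : ∀ {A B : Pred X (suc ℓ)} → A ⊆ B → int A ⊆ int B
  int-mono A⊆B (W , oW , W⊆A , x∈W) = W , oW , A⊆B ∘ W⊆A , x∈W

  int⟦⟧⊆int⟦□⟧ : ∀ φ {V} → int (⟦ φ ⟧ M V) ⊆ int (⟦ □ φ ⟧ M V)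
  int⟦⟧⊆int⟦□⟧ φ (W , oW , W⊆φ , x∈W) =
    W , oW , (λ w → proj₁ (W⊆φ w) , W , oW , W⊆φ , w) , x∈W

  ⇒-elim : ∀ {P Q : Set (suc ℓ)} → ¬ (P × ¬ Q) → P → Q
  ⇒-elim f p = dne λ ¬q → f (p , ¬q)

  int-⇒ : ∀ φ ψ {V} → int (⟦ φ ⇒ ψ ⟧ M V) ⊆
          λ x → int (⟦ φ ⟧ M V) x → int (⟦ ψ ⟧ M V) x
  int-⇒ φ ψ (W₁ , o₁ , s₁ , x∈W₁) (W₂ , o₂ , s₂ , x∈W₂) =
    _ , ∩-open o₁ o₂ ,
    (λ (w₁ , w₂) → proj₁ (s₁ w₁) , ⇒-elim (proj₂ (s₁ w₁)) (proj₂ (s₂ w₂))) ,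
    x∈W₁ , x∈W₂

  truth : X → Pred X ℓ → Formula PROP → Bool
  truth x V φ = does (em {⟨ M , x , V ⟩⊨ φ})

  -- By excluded middle `truth x V` respects the connectives, so it is recovered from its values on
  -- atoms and modal formulas. Hence tautologies are true at every scenario.
  eval-truth : ∀ x V φ → eval (truth x V) φ ≡ truth x V φ
  eval-truth x V (atom p) = refl
  eval-truth x V (~ φ) rewrite eval-truth x V φ
    with em {⟨ M , x , V ⟩⊨ φ} | em {⟨ M , x , V ⟩⊨ (~ φ)}
  ... | yes p | yes q = ⊥-elim (q p)
  ... | yes p | no ¬q = refl
  ... | no ¬p | yes q = refl
  ... | no ¬p | no ¬q = ⊥-elim (¬q ¬p)
  eval-truth x V (φ ∧ ψ) rewrite eval-truth x V φ | eval-truth x V ψ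
    with em {⟨ M , x , V ⟩⊨ φ} | em {⟨ M , x , V ⟩⊨ ψ} | em {⟨ M , x , V ⟩⊨ (φ ∧ ψ)}
  ... | yes p | yes q | yes r = refl
  ... | yes p | yes q | no ¬r = ⊥-elim (¬r (p , q))
  ... | yes p | no ¬q | yes r = ⊥-elim (¬q (proj₂ r))
  ... | yes p | no ¬q | no ¬r = refl
  ... | no ¬p | _     | yes r = ⊥-elim (¬p (proj₁ r))
  ... | no ¬p | _     | no ¬r = refl
  eval-truth x V (K φ) = refl
  eval-truth x V (□ φ) = refl
  eval-truth x V (B φ) = refl

  tautology-sound : ∀ {φ} → Tautology φ → ValidIn M φ
  tautology-sound {φ} t x V _ _
    with em {⟨ M , x , V ⟩⊨ φ} | trans (sym (eval-truth x V φ)) (t (truth x V))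
  ... | yes p | _ = p

  sound : ∀ {φ} → ⊢ φ → ValidIn M φ
  sound (taut t) = tautology-sound t
  sound (MP d e) x V oV x∈V = ⇒-elim (sound d x V oV x∈V) (sound e x V oV x∈V)
  sound (K-K φ ψ) x V oV x∈V =
    λ (f , ¬q) → ¬q λ (p , ¬r) → ¬r λ y y∈V → ⇒-elim (f y y∈V) (p y y∈V)
  sound (K-T φ) x V oV x∈V = λ (p , ¬q) → ¬q (p x x∈V)
  sound (K-4 φ) x V oV x∈V = λ (p , ¬q) → ¬q λ _ _ → p
  sound (K-5 φ) x V oV x∈V = λ (¬p , ¬q) → ¬q λ _ _ → ¬p
  sound (K-nec d) x V oV x∈V y y∈V = sound d y V oV y∈V
  sound (□-K φ ψ) x V oV x∈V = λ (f , ¬q) → ¬q λ (p , ¬r) → ¬r (int-⇒ φ ψ f p)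
  sound (□-T φ) x V oV x∈V = λ ((W , _ , W⊆φ , x∈W) , ¬q) → ¬q (proj₂ (W⊆φ x∈W))
  sound (□-4 φ) x V oV x∈V = λ (p , ¬q) → ¬q (int⟦⟧⊆int⟦□⟧ φ p)
  sound (□-nec d) x V oV x∈V = V , oV , (λ v → v , sound d _ V oV v) , x∈V
  sound (KI φ) x V oV x∈V = λ (p , ¬q) → ¬q (V , oV , (λ v → v , p _ v) , x∈V)
  sound (B-K φ ψ) x V oV x∈V = λ (f , ¬q) → ¬q λ (p , ¬r) → ¬r λ y∈V →
    cl-intro (int (⟦ ψ ⟧ M V)) λ W oW y∈W →
      -- Density is used twice: at `y`, and then at `z`, which lies in `V`, so that the interior of
      -- `φ` also meets the smaller open set `W ∩ W₁`.
      let z , z∈W , (W₁ , o₁ , s₁ , z∈W₁) = meets (int (⟦ φ ⇒ ψ ⟧ M V)) oW y∈W (f y∈V)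
          u , (u∈W , u∈W₁) , u∈φ =
            meets (int (⟦ φ ⟧ M V)) (∩-open oW o₁) (z∈W , z∈W₁) (p (proj₁ (s₁ z∈W₁)))
      in u , u∈W , int-⇒ φ ψ (W₁ , o₁ , s₁ , u∈W₁) u∈φ
  sound (sPI φ) x V oV x∈V = λ (p , ¬q) → ¬q λ _ _ → p
  sound (KB φ) x V oV x∈V = λ (p , ¬q) → ¬q λ y∈V →
    cl-intro (int (⟦ φ ⟧ M V)) λ W oW y∈W → _ , y∈W , V , oV , (λ v → v , p _ v) , y∈V
  sound (RB φ) x V oV x∈V = λ (p , ¬q) → ¬q λ y∈V →
    cl-intro (int (⟦ □ φ ⟧ M V)) λ W oW y∈W →
      map₂ (map₂ (int⟦⟧⊆int⟦□⟧ φ)) (meets (int (⟦ φ ⟧ M V)) oW y∈W (p y∈V))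
  sound (wF φ) x V oV x∈V = λ (p , ¬q) → ¬q λ (W , oW , W⊆¬φ , x∈W) →
    let z , z∈W , (W′ , _ , W′⊆φ , z∈W′) = meets (int (⟦ φ ⟧ M V)) oW x∈W (p x∈V)
    in proj₂ (W⊆¬φ z∈W) (proj₂ (W′⊆φ z∈W′))
  sound (CB φ) x V oV x∈V {y} y∈V =
    cl-intro (int (⟦ □ φ ∨ □ (~ (□ φ)) ⟧ M V)) λ W oW y∈W → near W oW y∈W em
    where
    -- If `W` meets the interior of `φ`, the first disjunct holds around the common point. Otherwise
    -- `□ φ` fails throughout the open set `W ∩ V`, which gives the second disjunct around `y`.
    near : ∀ W → Open W → W y → Dec (∃[ z ] W z × int (⟦ φ ⟧ M V) z) →
           ∃[ z ] W z × int (⟦ □ φ ∨ □ (~ (□ φ)) ⟧ M V) z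
    near W oW y∈W (yes (z , z∈W , z∈φ)) =
      z , z∈W , int-mono (λ (v , p) → v , λ (¬p , _) → ¬p p) (int⟦⟧⊆int⟦□⟧ φ z∈φ)
    near W oW y∈W (no none) =
      y , y∈W ,
      int-mono (λ (v , p) → v , λ (_ , ¬p) → ¬p p)
        (int⟦⟧⊆int⟦□⟧ (~ (□ φ)) (_ , ∩-open oW oV ,
          (λ (w , v) → v , λ p → none (_ , w , p)) , y∈W , y∈V))

-- Theories and maximal consistent sets

record Theory (T : Formula PROP → Set) : Set where
  field
    thm : ∀ {φ} → ⊢ φ → T φ
    mp  : ∀ {φ ψ} → T (φ ⇒ ψ) → T φ → T ψ

  mp₂ : ∀ {φ ψ χ} → T (φ ⇒ (ψ ⇒ χ)) → T φ → T ψ → T χ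
  mp₂ f p q = mp (mp f p) q

⊢-theory : Theory {PROP} ⊢_
⊢-theory = record { thm = id ; mp = MP }

-- Maximal consistent sets, as Boolean homomorphisms so that they form a small type.
record MCS (PROP : Set) : Set where
  field
    val   : Formula PROP → Bool
    val-~ : ∀ φ → val (~ φ) ≡ not (val φ)
    val-∧ : ∀ φ ψ → val (φ ∧ ψ) ≡ val φ && val ψ
    val-⊢ : ∀ {φ} → ⊢ φ → val φ ≡ true

infix 4 _∋_

_∋_ : MCS PROP → Formula PROP → Set
x ∋ φ = MCS.val x φ ≡ true

module _ (x : MCS PROP) where

  open MCS x

  ∋-theory : Theory (x ∋_)
  ∋-theory = record { thm = val-⊢ ; mp = λ {φ} {ψ} → detach φ ψ }
    where
    detach : ∀ φ ψ → x ∋ φ ⇒ ψ → x ∋ φ → x ∋ ψ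
    detach φ ψ f p with val ψ | trans (sym (val-~ (φ ∧ ~ ψ))) f
      | val-∧ φ (~ ψ) | val-~ ψ
    ... | true  | _ | _ | _ = refl
    ... | false | g | h | k rewrite h | k | p = g

  ∋-~ : ∀ {φ} → x ∋ ~ φ → ¬ (x ∋ φ)
  ∋-~ {φ} q p with trans (sym q) (trans (val-~ φ) (cong not p))
  ... | ()

  ∌⇒∋~ : ∀ {φ} → ¬ (x ∋ φ) → x ∋ ~ φ
  ∌⇒∋~ {φ} ¬p with val φ | val-~ φ
  ... | true  | _ = ⊥-elim (¬p refl)
  ... | false | q = q

-- Propositional tautologies, by truth tables

⇒-const : (φ ψ : Formula PROP) → ⊢ φ ⇒ (ψ ⇒ φ)
⇒-const φ ψ = taut λ ρ → go (eval ρ φ) (eval ρ ψ)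
  where
  go : ∀ a b → not (a && not (not (b && not a))) ≡ true
  go true  true  = refl
  go true  false = refl
  go false _     = refl

⇒-dist : (φ ψ χ : Formula PROP) → ⊢ (φ ⇒ (ψ ⇒ χ)) ⇒ ((φ ⇒ ψ) ⇒ (φ ⇒ χ))
⇒-dist φ ψ χ = taut λ ρ → go (eval ρ φ) (eval ρ ψ) (eval ρ χ)
  where
  _→b_ : Bool → Bool → Bool
  a →b b = not (a && not b)
  go : ∀ a b c → ((a →b (b →b c)) →b ((a →b b) →b (a →b c))) ≡ true
  go true  true  true  = refl
  go true  true  false = refl
  go true  false true  = refl
  go true  false false = refl
  go false _     _     = refl

~⇒-const : (φ ψ : Formula PROP) → ⊢ ~ (ψ ⇒ φ) ⇒ ~ φ
~⇒-const φ ψ = taut λ ρ → go (eval ρ φ) (eval ρ ψ)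
  where
  go : ∀ a b → not (not (not (b && not a)) && not (not a)) ≡ true
  go true  true  = refl
  go true  false = refl
  go false true  = refl
  go false false = refl

~⇒-hyp : (φ ψ : Formula PROP) → ⊢ ~ (ψ ⇒ φ) ⇒ ψ
~⇒-hyp φ ψ = taut λ ρ → go (eval ρ φ) (eval ρ ψ)
  where
  go : ∀ a b → not (not (not (b && not a)) && not b) ≡ true
  go true  true  = refl
  go true  false = refl
  go false true  = refl
  go false false = refl

contraposition : (φ ψ : Formula PROP) → ⊢ (ψ ⇒ φ) ⇒ (~ φ ⇒ ~ ψ)
contraposition φ ψ = taut λ ρ → go (eval ρ φ) (eval ρ ψ)
  where
  go : ∀ a b → not (not (b && not a) && not (not (not a && not (not b)))) ≡ true
  go true  true  = refl
  go true  false = refl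
  go false true  = refl
  go false false = refl

reductio : (φ ψ : Formula PROP) → ⊢ (~ φ ⇒ ψ) ⇒ ((~ φ ⇒ ~ ψ) ⇒ φ)
reductio φ ψ = taut λ ρ → go (eval ρ φ) (eval ρ ψ)
  where
  _→b_ : Bool → Bool → Bool
  a →b b = not (a && not b)
  go : ∀ a b → ((not a →b b) →b ((not a →b not b) →b a)) ≡ true
  go true  true  = refl
  go true  false = refl
  go false true  = refl
  go false false = refl

∧-intro : (φ ψ : Formula PROP) → ⊢ φ ⇒ (ψ ⇒ φ ∧ ψ)
∧-intro φ ψ = taut λ ρ → go (eval ρ φ) (eval ρ ψ)
  where
  go : ∀ a b → not (a && not (not (b && not (a && b)))) ≡ true
  go true  true  = refl
  go true  false = refl
  go false _     = refl

∧-elimˡ : (φ ψ : Formula PROP) → ⊢ φ ∧ ψ ⇒ φ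
∧-elimˡ φ ψ = taut λ ρ → go (eval ρ φ) (eval ρ ψ)
  where
  go : ∀ a b → not ((a && b) && not a) ≡ true
  go true  true  = refl
  go true  false = refl
  go false _     = refl

∧-elimʳ : (φ ψ : Formula PROP) → ⊢ φ ∧ ψ ⇒ ψ
∧-elimʳ φ ψ = taut λ ρ → go (eval ρ φ) (eval ρ ψ)
  where
  go : ∀ a b → not ((a && b) && not b) ≡ true
  go true  true  = refl
  go true  false = refl
  go false _     = refl

∨-resolve : (φ ψ : Formula PROP) → ⊢ φ ∨ ψ ⇒ (~ ψ ⇒ φ)
∨-resolve φ ψ = taut λ ρ → go (eval ρ φ) (eval ρ ψ)
  where
  go : ∀ a b → not (not (not a && not b) && not (not (not b && not a))) ≡ true
  go true  true  = refl
  go true  false = refl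
  go false true  = refl
  go false false = refl

-- Complete theories as maximal consistent sets; enumeration of the formulas

module Completeness (em : ExcludedMiddle Level.zero) {PROP : Set}
                    (count : PROP ↣ ℕ) where

  complete⇒MCS : {T : Formula PROP → Set} → Theory T →
                 (∀ φ → T φ ⊎ T (~ φ)) → (∀ {φ} → T φ → ¬ T (~ φ)) →
                 ∃[ x ] (∀ {φ} → T φ → x ∋ φ)
  complete⇒MCS {T} theory total consistent =
    record { val = member ; val-~ = member-~ ; val-∧ = member-∧ ; val-⊢ = ∈⇒member ∘ thm } ,
    ∈⇒member
    where
    open Theory theory
    member : Formula PROP → Bool
    member φ = does (em {T φ})
    ∈⇒member : ∀ {φ} → T φ → member φ ≡ true
    ∈⇒member {φ} p with em {T φ}
    ... | yes _ = refl
    ... | no ¬p = ⊥-elim (¬p p)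
    member-~ : ∀ φ → member (~ φ) ≡ not (member φ)
    member-~ φ with em {T φ} | em {T (~ φ)}
    ... | yes p | yes q = ⊥-elim (consistent p q)
    ... | yes p | no ¬q = refl
    ... | no ¬p | yes q = refl
    ... | no ¬p | no ¬q = ⊥-elim ([ ¬p , ¬q ]′ (total φ))
    member-∧ : ∀ φ ψ → member (φ ∧ ψ) ≡ member φ && member ψ
    member-∧ φ ψ with em {T φ} | em {T ψ} | em {T (φ ∧ ψ)}
    ... | yes p | yes q | yes r = refl
    ... | yes p | yes q | no ¬r = ⊥-elim (¬r (mp₂ (thm (∧-intro φ ψ)) p q))
    ... | yes p | no ¬q | yes r = ⊥-elim (¬q (mp (thm (∧-elimʳ φ ψ)) r))
    ... | yes p | no ¬q | no ¬r = refl
    ... | no ¬p | _     | yes r = ⊥-elim (¬p (mp (thm (∧-elimˡ φ ψ)) r))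
    ... | no ¬p | _     | no ¬r = refl

  atoms : ℕ → List PROP
  -- `count` comes without an inverse, so excluded middle decides whether `n` codes an atom;
  -- injectivity makes that atom unique.
  atoms n with em {∃[ p ] Injection.to count p ≡ n}
  ... | yes (p , _) = [ p ]
  ... | no _        = []

  ∈-atoms : ∀ p → p ∈ atoms (Injection.to count p)
  ∈-atoms p with em {∃[ q ] Injection.to count q ≡ Injection.to count p}
  ... | yes (q , e) = here (sym (Injection.injective count e))
  ... | no none     = ⊥-elim (none (p , refl))

  compounds : List (Formula PROP) → List (Formula PROP)
  compounds l = map ~_ l ++ cartesianProductWith _∧_ l l ++
                map K_ l ++ map □_ l ++ map B_ l

  module _ {l : List (Formula PROP)} where

    private
      in~ : List (Formula PROP)
      in~ = map ~_ l
      in∧ : List (Formula PROP)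
      in∧ = cartesianProductWith _∧_ l l

    ~∈compounds : ∀ {φ} → φ ∈ l → ~ φ ∈ compounds l
    ~∈compounds p = ∈-++⁺ˡ (∈-map⁺ ~_ p)

    ∧∈compounds : ∀ {φ ψ} → φ ∈ l → ψ ∈ l → φ ∧ ψ ∈ compounds l
    ∧∈compounds p q = ∈-++⁺ʳ in~ (∈-++⁺ˡ (∈-cartesianProductWith⁺ _∧_ p q))

    K∈compounds : ∀ {φ} → φ ∈ l → K φ ∈ compounds l
    K∈compounds p = ∈-++⁺ʳ in~ (∈-++⁺ʳ in∧ (∈-++⁺ˡ (∈-map⁺ K_ p)))

    □∈compounds : ∀ {φ} → φ ∈ l → □ φ ∈ compounds l
    □∈compounds p =
      ∈-++⁺ʳ in~ (∈-++⁺ʳ in∧ (∈-++⁺ʳ (map K_ l) (∈-++⁺ˡ (∈-map⁺ □_ p))))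

    B∈compounds : ∀ {φ} → φ ∈ l → B φ ∈ compounds l
    B∈compounds p =
      ∈-++⁺ʳ in~ (∈-++⁺ʳ in∧ (∈-++⁺ʳ (map K_ l) (∈-++⁺ʳ (map □_ l) (∈-map⁺ B_ p))))

  -- The lists are cumulative so that the two parts of a conjunction, found at different stages, are
  -- both present at the larger one.
  formulas : ℕ → List (Formula PROP)
  formulas zero    = []
  formulas (ℕ.suc n) = formulas n ++ map atom (atoms n) ++ compounds (formulas n)

  formulas-mono : ∀ {m n φ} → m ≤ n → φ ∈ formulas m → φ ∈ formulas n
  formulas-mono m≤n = go (≤⇒≤′ m≤n)
    where
    go : ∀ {m n φ} → m ≤′ n → φ ∈ formulas m → φ ∈ formulas n
    go ≤′-refl     p = p
    go (≤′-step s) p = ∈-++⁺ˡ (go s p)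

  enumerated : ∀ φ → ∃[ n ] φ ∈ formulas n
  compound   : ∀ {φ} n → φ ∈ compounds (formulas n) → ∃[ m ] φ ∈ formulas m
  compound n p = ℕ.suc n , ∈-++⁺ʳ (formulas n) (∈-++⁺ʳ (map atom (atoms n)) p)

  enumerated (atom p) = let n = Injection.to count p in
    ℕ.suc n , ∈-++⁺ʳ (formulas n) (∈-++⁺ˡ (∈-map⁺ atom (∈-atoms p)))
  enumerated (~ φ) = let n , p = enumerated φ in compound n (~∈compounds p)
  enumerated (φ ∧ ψ) =
    let m , p = enumerated φ
        n , q = enumerated ψ
    in compound (m ⊔ n)
         (∧∈compounds (formulas-mono (m≤m⊔n m n) p) (formulas-mono (m≤n⊔m m n) q))
  enumerated (K φ) = let n , p = enumerated φ in compound n (K∈compounds p)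
  enumerated (□ φ) = let n , p = enumerated φ in compound n (□∈compounds p)
  enumerated (B φ) = let n , p = enumerated φ in compound n (B∈compounds p)

  -- Lindenbaum's lemma

  -- A theory that omits θ is extended along a sequence of formulas χ n ∉ T,
  -- starting at θ: stage n is the theory generated by T and ~ χ n, and ψ is added
  -- to it by passing from χ to ψ ⇒ χ.
  module Lindenbaum {T : Formula PROP → Set} (theory : Theory T)
                    {θ : Formula PROP} (θ∉T : ¬ T θ) where

    open Theory theory

    Stage : Formula PROP → Formula PROP → Set
    Stage χ ψ = T (~ χ ⇒ ψ)

    stage-theory : ∀ χ → Theory (Stage χ)
    stage-theory χ = record
      { thm = λ d → mp (thm (⇒-const _ _)) (thm d)
      ; mp  = mp₂ (thm (⇒-dist _ _ _))
      }

    _≼_ : Formula PROP → Formula PROP → Set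
    χ ≼ χ′ = ∀ {ψ} → Stage χ ψ → Stage χ′ ψ

    -- If `T` contains `ψ ⇒ χ`, the stage of `χ` already contains `~ ψ` by contraposition and
    -- nothing changes. Otherwise the new formula `ψ ⇒ χ` is outside `T` by the case distinction
    -- itself, and its negation yields both `ψ` and `~ χ`.
    step : Formula PROP → Formula PROP → Formula PROP
    step ψ χ with em {T (ψ ⇒ χ)}
    ... | yes _ = χ
    ... | no  _ = ψ ⇒ χ

    step-∉ : ∀ ψ {χ} → ¬ T χ → ¬ T (step ψ χ)
    step-∉ ψ {χ} χ∉T with em {T (ψ ⇒ χ)}
    ... | yes _ = χ∉T
    ... | no ¬p = ¬p

    step-≼ : ∀ ψ χ → χ ≼ step ψ χ
    step-≼ ψ χ p with em {T (ψ ⇒ χ)}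
    ... | yes _ = p
    ... | no  _ = mp₂ (thm (⇒-dist _ _ _))
                    (mp (thm (⇒-const _ _)) p) (thm (~⇒-const χ ψ))

    step-decides : ∀ ψ χ → Stage (step ψ χ) ψ ⊎ Stage (step ψ χ) (~ ψ)
    step-decides ψ χ with em {T (ψ ⇒ χ)}
    ... | yes p = inj₂ (mp (thm (contraposition χ ψ)) p)
    ... | no  _ = inj₁ (thm (~⇒-hyp χ ψ))

    steps : Formula PROP → List (Formula PROP) → Formula PROP
    steps = foldr step

    steps-∉ : ∀ l {χ} → ¬ T χ → ¬ T (steps χ l)
    steps-∉ []      χ∉T = χ∉T
    steps-∉ (ψ ∷ l) χ∉T = step-∉ ψ (steps-∉ l χ∉T)

    steps-≼ : ∀ l χ → χ ≼ steps χ l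
    steps-≼ []      χ p = p
    steps-≼ (ψ ∷ l) χ p = step-≼ ψ (steps χ l) (steps-≼ l χ p)

    steps-decide : ∀ {ψ} l χ → ψ ∈ l → Stage (steps χ l) ψ ⊎ Stage (steps χ l) (~ ψ)
    steps-decide (ψ ∷ l) χ (here refl) = step-decides ψ (steps χ l)
    steps-decide (ξ ∷ l) χ (there ψ∈l) =
      [ inj₁ ∘ step-≼ ξ _ , inj₂ ∘ step-≼ ξ _ ]′ (steps-decide l χ ψ∈l)

    χ : ℕ → Formula PROP
    χ zero    = θ
    -- A whole list is decided at once; meeting formulas again that were decided earlier does no
    -- harm.
    χ (ℕ.suc n) = steps (χ n) (formulas n)

    χ∉T : ∀ n → ¬ T (χ n)
    χ∉T zero    = θ∉T
    χ∉T (ℕ.suc n) = steps-∉ (formulas n) (χ∉T n)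

    χ-mono : ∀ {m n} → m ≤ n → χ m ≼ χ n
    χ-mono m≤n = go (≤⇒≤′ m≤n)
      where
      go : ∀ {m n} → m ≤′ n → χ m ≼ χ n
      go ≤′-refl         p = p
      go (≤′-step {n} s) p = steps-≼ (formulas n) (χ n) (go s p)

    Limit : Formula PROP → Set
    Limit ψ = ∃[ n ] Stage (χ n) ψ

    joint : ∀ {φ ψ} → Limit φ → Limit ψ → ∃[ n ] Stage (χ n) φ × Stage (χ n) ψ
    joint (m , p) (n , q) = m ⊔ n , χ-mono (m≤m⊔n m n) p , χ-mono (m≤n⊔m m n) q

    limit-theory : Theory Limit
    limit-theory = record
      { thm = λ d → zero , Theory.thm (stage-theory θ) d
      ; mp  = λ p q → let n , p′ , q′ = joint p q in n , Theory.mp (stage-theory (χ n)) p′ q′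
      }

    limit-total : ∀ ψ → Limit ψ ⊎ Limit (~ ψ)
    limit-total ψ = let n , ψ∈ = enumerated ψ in
      [ inj₁ ∘ (ℕ.suc n ,_) , inj₂ ∘ (ℕ.suc n ,_) ]′ (steps-decide (formulas n) (χ n) ψ∈)

    -- A contradiction would already occur at a single stage `n`, where `reductio` puts `χ n` into
    -- `T`.
    limit-consistent : ∀ {ψ} → Limit ψ → ¬ Limit (~ ψ)
    limit-consistent p q = let n , p′ , q′ = joint p q in
      χ∉T n (mp₂ (thm (reductio _ _)) p′ q′)

    extension : ∃[ x ] (∀ {φ} → T φ → x ∋ φ) × x ∋ ~ θ
    extension = let x , Limit⊆x = complete⇒MCS limit-theory limit-total limit-consistent in
      x , (λ p → Limit⊆x (zero , mp (thm (⇒-const _ _)) p)) ,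
      -- Stage zero is generated by `T` and `~ θ`, so membership of `~ θ` is the tautology
      -- `~ θ ⇒ ~ θ`.
      Limit⊆x (zero , thm (taut λ ρ → excluded (eval ρ θ)))
      where
      excluded : ∀ a → not (not a && not (not a)) ≡ true
      excluded true  = refl
      excluded false = refl

  -- Theories under a modality; belief as `K ◇ □`

  module _ (x : MCS PROP) where
    open Theory (∋-theory x) using (thm; mp; mp₂)

    -- This form lets Lindenbaum's lemma apply to what `x` puts under `K`, and lets derivations be
    -- carried out under the modality.
    K-theory : Theory (λ φ → x ∋ K φ)
    K-theory = record { thm = thm ∘ K-nec ; mp = mp₂ (thm (K-K _ _)) }

    □-theory : Theory (λ φ → x ∋ □ φ)
    □-theory = record { thm = thm ∘ □-nec ; mp = mp₂ (thm (□-K _ _)) }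

    B-theory : Theory (λ φ → x ∋ B φ)
    B-theory = record { thm = λ d → mp (thm (KB _)) (thm (K-nec d)) ; mp = mp₂ (thm (B-K _ _)) }

    -- `sPI` puts `B φ` under `K`; there `RB` gives `B (□ φ)`, and `wF` for `□ φ` gives the result.
    B⇒K◇□ : ∀ {φ} → x ∋ B φ → x ∋ K (◇ (□ φ))
    B⇒K◇□ {φ} p = Theory.mp K-theory (thm (K-nec (wF (□ φ))))
      (Theory.mp K-theory (thm (K-nec (RB φ))) (mp (thm (sPI φ)) p))

    -- By `KB` the formula `◇ (□ φ)` is believed. It is the negation of the second disjunct of `CB`,
    -- so resolution under `B` leaves `□ φ`, hence `φ`.
    K◇□⇒B : ∀ {φ} → x ∋ K (◇ (□ φ)) → x ∋ B φ
    K◇□⇒B {φ} p = B.mp (B.thm (□-T φ))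
      (B.mp₂ (B.thm (∨-resolve (□ φ) (□ (~ (□ φ))))) (thm (CB φ)) (mp (thm (KB _)) p))
      where module B = Theory B-theory

  -- The canonical relations and existence of witnesses

  infix 4 _≈_ _≲_

  record _≈_ (x y : MCS PROP) : Set where
    constructor agreeing
    field agree : ∀ φ → MCS.val x (K φ) ≡ MCS.val y (K φ)

  record _≲_ (x y : MCS PROP) : Set where
    constructor accessing
    field access : ∀ {φ} → x ∋ □ φ → y ∋ φ

  open _≈_
  open _≲_

  ≈-refl : ∀ {x} → x ≈ x
  ≈-refl = agreeing λ _ → refl

  ≈-trans : ∀ {x y z} → x ≈ y → y ≈ z → x ≈ z
  ≈-trans x≈y y≈z = agreeing λ φ → trans (agree x≈y φ) (agree y≈z φ)

  ≲-refl : ∀ {x} → x ≲ x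
  ≲-refl {x} = accessing (mp (thm (□-T _)))
    where open Theory (∋-theory x)

  ≲-trans : ∀ {x y z} → x ≲ y → y ≲ z → x ≲ z
  ≲-trans {x} x≲y y≲z = accessing λ p → access y≲z (access x≲y (mp (thm (□-4 _)) p))
    where open Theory (∋-theory x)

  -- Axiom 4 carries `K φ` from `x` to `y` and axiom 5 carries `~ (K φ)`, so the values cannot
  -- differ in either direction.
  K⊆⇒≈ : ∀ {x y} → (∀ {φ} → x ∋ K φ → y ∋ φ) → x ≈ y
  K⊆⇒≈ {x} {y} K⊆ = agreeing go
    where
    open Theory (∋-theory x)
    go : ∀ φ → MCS.val x (K φ) ≡ MCS.val y (K φ)
    go φ with MCS.val x (K φ) in eq
    ... | true  = sym (K⊆ (mp (thm (K-4 φ)) eq))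
    ... | false with MCS.val y (K φ) in eq′
    ...   | false = refl
    ...   | true  = ⊥-elim (∋-~ y (K⊆ (mp (thm (K-5 φ)) x∋~Kφ)) eq′)
      where
      x∋~Kφ : x ∋ ~ (K φ)
      x∋~Kφ = trans (MCS.val-~ x (K φ)) (cong not eq)

  -- This is where `KI` enters; it makes every `≈`-class closed under `≲`.
  ≲⇒≈ : ∀ {x y} → x ≲ y → x ≈ y
  ≲⇒≈ {x} x≲y = K⊆⇒≈ (access x≲y ∘ mp (thm (KI _)))
    where open Theory (∋-theory x)

  -- If `K φ` is missing, `K-theory x` omits `φ` and extends to some `y` containing `~ φ`; such a
  -- `y` is equivalent to `x`.
  K-witness : ∀ x {φ} → (∀ y → x ≈ y → y ∋ φ) → x ∋ K φ
  K-witness x f = decidable-stable em λ Kφ∉x →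
    let y , K⊆ , y∌φ = Lindenbaum.extension (K-theory x) Kφ∉x
    in ∋-~ y y∌φ (f y (K⊆⇒≈ K⊆))

  □-witness : ∀ x {φ} → (∀ y → x ≲ y → y ∋ φ) → x ∋ □ φ
  □-witness x f = decidable-stable em λ □φ∉x →
    let y , x≲y , y∌φ = Lindenbaum.extension (□-theory x) □φ∉x
    in ∋-~ y y∌φ (f y (accessing x≲y))

  -- The canonical model and its truth lemma

  module Canonical {ℓ : Level} (emℓ : ExcludedMiddle ℓ) (x₀ : MCS PROP) where

    -- The Alexandrov topology of the preorder `≲`.
    upsets : Topology (Lift ℓ (MCS PROP))
    upsets = record
      { Open   = λ V → Lift (suc ℓ) (∀ {x y} → lower x ≲ lower y → V x → V y)
      ; resp-≐ = λ (V⊆W , W⊆V) (lift up) → lift λ r → V⊆W ∘ up r ∘ W⊆V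
      ; ∅-open = lift λ _ ()
      ; U-open = lift λ _ u → u
      ; ∩-open = λ (lift up₁) (lift up₂) → lift λ r (p , q) → up₁ r p , up₂ r q
      ; ⋃-open = λ V up → lift λ r (i , p) → i , lower (up i) r p
      }

    canonical : Model ℓ PROP
    canonical = record
      { X        = Lift ℓ (MCS PROP)
      ; nonempty = lift x₀
      ; topology = upsets
      ; v        = λ p x → Lift ℓ (lower x ∋ atom p)
      }

    open Model canonical using (X; Open; int)

    class : Pred X ℓ
    class x = Lift ℓ (x₀ ≈ lower x)

    class-open : Open class
    class-open = lift λ x≲y (lift x₀≈x) → lift (≈-trans x₀≈x (≲⇒≈ x≲y))

    -- The least open neighbourhood of `x`.
    up : MCS PROP → Pred X ℓ
    up x y = Lift ℓ (x ≲ lower y)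

    up-open : ∀ x → Open (up x)
    up-open x = lift λ y≲z (lift x≲y) → lift (≲-trans x≲y y≲z)

    -- Both directions go by one induction on `φ`, since negation exchanges them. The epistemic
    -- range stays fixed at `class`, over which `K` quantifies.
    sat⇒∋ : ∀ φ {x} → class (lift x) → ⟨ canonical , lift x , class ⟩⊨ φ → x ∋ φ
    ∋⇒sat : ∀ φ {x} → class (lift x) → x ∋ φ → ⟨ canonical , lift x , class ⟩⊨ φ
    int⇒∋□ : ∀ φ {x} → int (⟦ φ ⟧ canonical class) (lift x) → x ∋ □ φ
    ∋□⇒int : ∀ φ {x} → class (lift x) → x ∋ □ φ → int (⟦ φ ⟧ canonical class) (lift x)

    int⇒∋□ φ {x} (W , lift oW , W⊆φ , x∈W) = □-witness x λ y x≲y →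
      let y∈class , p = W⊆φ (oW x≲y x∈W) in sat⇒∋ φ y∈class p

    ∋□⇒int φ {x} (lift x₀≈x) p =
      up x , up-open x ,
      (λ (lift x≲y) → let y∈class = lower class-open x≲y (lift x₀≈x)
                      in y∈class , ∋⇒sat φ y∈class (access x≲y p)) ,
      lift ≲-refl

    sat⇒∋ (atom p) _ (lift (lift q)) = q
    sat⇒∋ (~ φ) {x} c ¬p = ∌⇒∋~ x (¬p ∘ ∋⇒sat φ c)
    sat⇒∋ (φ ∧ ψ) {x} c (p , q) =
      trans (MCS.val-∧ x φ ψ) (cong₂ _&&_ (sat⇒∋ φ c p) (sat⇒∋ ψ c q))
    sat⇒∋ (K φ) {x} (lift x₀≈x) p = K-witness x λ y x≈y →
      let c = lift (≈-trans x₀≈x x≈y) in sat⇒∋ φ c (p (lift y) c)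
    sat⇒∋ (□ φ) c p = int⇒∋□ φ p
    sat⇒∋ (B φ) {x} (lift x₀≈x) p = K◇□⇒B x (K-witness x λ y x≈y →
      ∌⇒∋~ y λ y∋□~□φ →
        -- If `y` contains `□ (~ (□ φ))`, no point of `up y` contains `□ φ`, so the closed set
        -- `∁ (up y)` includes the interior of `φ`. Belief then places `y` itself in `∁ (up y)`,
        -- which is absurd.
        p (lift (≈-trans x₀≈x x≈y)) (∁ (up y))
          (lift λ z≲w ¬z∉ w∉ → ¬z∉ λ z∈ → w∉ (lower (up-open y) z≲w z∈))
          (λ {z} z∈int (lift y≲z) → ∋-~ (lower z) (access y≲z y∋□~□φ) (int⇒∋□ φ z∈int))
          (lift ≲-refl))

    ∋⇒sat (atom p) _ q = lift (lift q)
    ∋⇒sat (~ φ) {x} c q p = ∋-~ x q (sat⇒∋ φ c p)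
    ∋⇒sat (φ ∧ ψ) {x} c p =
      ∋⇒sat φ c (mp (thm (∧-elimˡ φ ψ)) p) , ∋⇒sat ψ c (mp (thm (∧-elimʳ φ ψ)) p)
      where open Theory (∋-theory x)
    ∋⇒sat (K φ) {x} (lift x₀≈x) p (lift y) (lift x₀≈y) =
      ∋⇒sat φ (lift x₀≈y)
        (mp (thm (K-T φ)) (trans (sym (agree x₀≈y φ)) (trans (agree x₀≈x φ) p)))
      where open Theory (∋-theory y)
    ∋⇒sat (□ φ) c p = ∋□⇒int φ c p
    ∋⇒sat (B φ) {x} (lift x₀≈x) p {lift y} (lift x₀≈y) C (lift closed) int⊆C =
      -- The complement of `C` is an up-set, so if it contained `y`, no successor of `y` could
      -- contain `□ φ`. Then `y` would contain `□ (~ (□ φ))`, against `◇ (□ φ)`.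
      decidable-stable emℓ λ y∉C →
        ∋-~ y y∋◇□φ (□-witness y λ z y≲z → ∌⇒∋~ z λ z∋□φ →
          closed y≲z y∉C (int⊆C (∋□⇒int φ (lower class-open y≲z (lift x₀≈y)) z∋□φ)))
      where
      y∋◇□φ : y ∋ ◇ (□ φ)
      y∋◇□φ = mp (thm (K-T _)) (trans (sym (agree x₀≈y _)) (trans (agree x₀≈x _) (B⇒K◇□ x p)))
        where open Theory (∋-theory y)

theorem5 : (ℓ : Level) → ExcludedMiddle (suc ℓ) →
    (PROP : Set) → PROP ↣ ℕ →
    (φ : Formula PROP) → Valid ℓ φ ⇔ (⊢ φ)
theorem5 ℓ em PROP count φ = mk⇔ complete (λ d M → Soundness.sound em M d)
  where
  em₀ : ExcludedMiddle Level.zero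
  em₀ = lower-em (suc ℓ) em
  open Completeness em₀ count
  complete : Valid ℓ φ → ⊢ φ
  complete valid = decidable-stable em₀ λ ⊬φ →
    -- Applied to the theory of all theorems, Lindenbaum's lemma gives a point containing `~ φ`;
    -- validity is tested there, with its own class as epistemic range.
    let x , _ , x∌φ = Lindenbaum.extension ⊢-theory ⊬φ
        open Canonical (lower-em (suc ℓ) em) x
    in ∋-~ x x∌φ (sat⇒∋ φ (lift ≈-refl) (valid canonical (lift x) class class-open (lift ≈-refl)))
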